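{- For every integer $t \geq 4$, $R(P_{t}^{+}, P_{t}^{+}) = 2t - 1$.
   Context: For $t \geq 3$, $P_t$ denotes the path on $t$ vertices $v_1v_2\cdots v_t$, and $P_t^{+}$ denotes the graph obtained from $P_t$ by adding the edge $v_1v_3$ (so that an end vertex together with the vertex at distance $2$ from it along the path forms a triangle). For graphs $G,H$, the Ramsey number $R(G,H)$ is the minimum integer $n$ such that every coloring of the edges of $K_n$ with red and blue contains a red copy of $G$ or a blue copy of $H$. -}

module Defs where

open import Data.Nat using (ℕ; zero; suc; _<_)
open import Data.Fin using (Fin; toℕ)
open import Data.Bool using (Bool; true; false)
open import Data.Product using (Σ; _×_)
open import Data.Sum using (_⊎_)
open import Relation.Nullary using (¬_)
open import Relation.Binary.PropositionalEquality using (_≡_)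
open import Function.Definitions using (Injective)

Graph : ℕ → Set₁
Graph k = Fin k → Fin k → Set

-- A red/blue colouring of the edges of K_n: a symmetric Bool-valued
-- function on pairs (values on the diagonal are irrelevant).
-- Convention: true = red, false = blue.
record Colouring (n : ℕ) : Set where
  field
    col : Fin n → Fin n → Bool
    sym : ∀ i j → col i j ≡ col j i
open Colouring public

red blue : Bool
red = true
blue = false

MonoCopy : ∀ {k} → Graph k → (n : ℕ) → Colouring n → Bool → Set
MonoCopy {k} G n c b =
  Σ (Fin k → Fin n) λ f →
    Injective _≡_ _≡_ f × (∀ i j → G i j → col c (f i) (f j) ≡ b)

Arrows : ∀ {k l} → ℕ → Graph k → Graph l → Set
Arrows n G H = (c : Colouring n) → MonoCopy G n c red ⊎ MonoCopy H n c blue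

IsRamseyNumber : ∀ {k l} → Graph k → Graph l → ℕ → Set
IsRamseyNumber G H N = Arrows N G H × (∀ m → m < N → ¬ Arrows m G H)

-- P_t on vertices v_1 … v_t, here 0-indexed as Fin t: edges {i, i+1}.
PathEdge : (t : ℕ) → Graph t
PathEdge t i j = toℕ j ≡ suc (toℕ i) ⊎ toℕ i ≡ suc (toℕ j)

-- P_t^+ : P_t plus the edge v_1 v_3 (0-indexed: vertices 0 and 2).
PathPlus : (t : ℕ) → Graph t
PathPlus t i j =
  PathEdge t i j ⊎ ((toℕ i ≡ 0 × toℕ j ≡ 2) ⊎ (toℕ i ≡ 2 × toℕ j ≡ 0))

{-# OPTIONS --safe #-}
module Submission where

-- Two disjoint red cliques on t - 1 vertices, with blue edges between them, give the
-- lower bound.  For the upper bound, take disjoint lollipops (copies of P_k⁺), P red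
-- with end p and Q blue with end q, and a vertex z outside both: either z extends one
-- of them, or zp is blue and zq red; then Q, p, z or P, q, z is a lollipop, according
-- to the colour of pq, and the total size has grown by one.  Starting from a total of
-- n + 2 this goes on until a lollipop reaches n vertices, as n + n - 2 vertices never
-- exhaust K_N.  Now lengthen a red lollipop L on n - 1 vertices with end v and
-- predecessor u.  If it does not extend, v is blue to the rest, and if the rest is no
-- red clique it has a blue edge ww′.  The colours among u, w, w′ and one more outside
-- vertex z then give either a red lollipop on n vertices or a pair of total n + 2.

open import Defs
open import Data.Nat using (ℕ; zero; suc; _+_; _*_; _∸_; _≤_; _<_; s≤s; s≤s⁻¹; _<ᵇ_; _≤?_)
open import Data.Nat.Properties
open import Data.Fin using (Fin; zero; suc; toℕ; fromℕ<; opposite; inject₁)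
open import Data.Fin.Properties using (toℕ<n; toℕ-injective; toℕ-inject₁; fromℕ<-injective; injective⇒≤; opposite-prop; opposite-involutive; ¬∀⟶∃¬)
import Data.Fin.Properties as Fin
open import Data.Fin.Induction using (<-weakInduction)
open import Data.Bool using (Bool; true; false; T; not; _xor_)
open import Data.Bool.Properties using (xor-comm)
open import Data.List using (List; []; _∷_; _++_; length; lookup)
open import Data.List.Membership.Propositional using (_∈_; _∉_)
open import Data.List.Membership.Propositional.Properties using (∈-lookup)
open import Data.List.Membership.Setoid.Properties using (index-injective)
open import Data.List.Properties using (length-++)
open import Data.List.Relation.Unary.All as All using (All; []; _∷_)
open import Data.List.Relation.Unary.All.Properties using (¬Any⇒All¬; ++⁻ˡ; ++⁻ʳ)
open import Data.List.Relation.Unary.AllPairs using (AllPairs; []; _∷_)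
open import Data.List.Relation.Unary.Unique.Propositional using (Unique)
open import Data.List.Relation.Unary.Unique.Propositional.Properties using (drop⁺)
open import Data.List.Relation.Binary.Permutation.Propositional using (_↭_; prep; swap; ↭-refl; ↭-trans; ↭-sym; ↭⇒↭ₛ)
open import Data.List.Relation.Binary.Permutation.Propositional.Properties using (++-comm; shift; shifts)
import Data.List.Relation.Binary.Permutation.Setoid.Properties as Permutationₛ
open import Data.Empty using (⊥)
open import Data.Unit using (tt)
open import Data.Product using (∃; ∃₂; _×_; _,_)
open import Data.Sum using (_⊎_; inj₁; inj₂; [_,_]′)
open import Function using (_∘_)
open import Function.Definitions using (Injective)
open import Relation.Nullary using (¬_; yes; no; contradiction)
open import Relation.Binary.PropositionalEquality using (_≡_; refl; cong; subst; trans; setoid) renaming (sym to ≡-sym)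

-- Repetition-free lists and fresh vertices.

Unique-resp-↭ : ∀ {A : Set} {xs ys : List A} → xs ↭ ys → Unique xs → Unique ys
Unique-resp-↭ {A} p = Permutationₛ.Unique-resp-↭ (setoid A) (↭⇒↭ₛ p)

lookup-injective : ∀ {A : Set} {xs : List A} → Unique xs → Injective _≡_ _≡_ (lookup xs)
lookup-injective {xs = _ ∷ _} (_   ∷ _)   {zero}  {zero}  _  = refl
lookup-injective {xs = _ ∷ _} (x≢  ∷ _)   {zero}  {suc j} eq = contradiction eq (All.lookup x≢ (∈-lookup j))
lookup-injective {xs = _ ∷ _} (x≢  ∷ _)   {suc i} {zero}  eq = contradiction (≡-sym eq) (All.lookup x≢ (∈-lookup i))
lookup-injective {xs = _ ∷ _} (_   ∷ xs!) {suc i} {suc j} eq = cong suc (lookup-injective xs! eq)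

-- If `xs` held every vertex, sending each to its position would inject `Fin n` into fewer than `n`
-- indices.
fresh : ∀ {n} (xs : List (Fin n)) → length xs < n → ∃ λ z → z ∉ xs
fresh {n} xs xs<n = ¬∀⟶∃¬ n (_∈ xs) (λ z → z ∈? xs) λ all∈ →
  <⇒≱ xs<n (injective⇒≤ (index-injective (setoid _) (all∈ _) (all∈ _)))
  where open import Data.List.Membership.DecPropositional (Fin._≟_ {n}) using (_∈?_)

cons! : ∀ {A : Set} {z : A} {xs} → z ∉ xs → Unique xs → Unique (z ∷ xs)
cons! {xs = xs} z∉ xs! = ¬Any⇒All¬ xs z∉ ∷ xs!

Unique-++⁻ˡ : ∀ {A : Set} (xs : List A) {ys} → Unique (xs ++ ys) → Unique xs
Unique-++⁻ˡ []       _          = []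
Unique-++⁻ˡ (_ ∷ xs) (x≢ ∷ xs!) = ++⁻ˡ xs x≢ ∷ Unique-++⁻ˡ xs xs!

Unique-++⁻ʳ : ∀ {A : Set} (xs : List A) {ys} → Unique (xs ++ ys) → Unique ys
Unique-++⁻ʳ []       ys!       = ys!
Unique-++⁻ʳ (_ ∷ xs) (_ ∷ xs!) = Unique-++⁻ʳ xs xs!

≡⊎≡not : ∀ x b → x ≡ b ⊎ x ≡ not b
≡⊎≡not false false = inj₁ refl
≡⊎≡not false true  = inj₂ refl
≡⊎≡not true  false = inj₂ refl
≡⊎≡not true  true  = inj₁ refl

-- Monochromatic lollipops as lists.

module _ {N} (c : Colouring N) where

  -- A monochromatic P_k⁺ listed from its end v_k down to v_1; the paths with at
  -- most two vertices are included so that dropping the head is always possible.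
  data Lollipop (b : Bool) : List (Fin N) → Set where
    empty    : Lollipop b []
    single   : ∀ {x} → Lollipop b (x ∷ [])
    edge     : ∀ {x y} → col c x y ≡ b → Lollipop b (x ∷ y ∷ [])
    triangle : ∀ {x y z} → col c x y ≡ b → col c y z ≡ b → col c z x ≡ b → Lollipop b (x ∷ y ∷ z ∷ [])
    extend   : ∀ {w x y z zs} → col c w x ≡ b → Lollipop b (x ∷ y ∷ z ∷ zs) → Lollipop b (w ∷ x ∷ y ∷ z ∷ zs)

  col-sym : ∀ {x y b} → col c x y ≡ b → col c y x ≡ b
  col-sym {x} {y} xy = trans (sym c y x) xy

  Lollipop-tail : ∀ {b x xs} → Lollipop b (x ∷ xs) → Lollipop b xs
  Lollipop-tail single            = empty
  Lollipop-tail (edge _)          = single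
  Lollipop-tail (triangle _ yz _) = edge yz
  Lollipop-tail (extend _ l)      = l

  Lollipop-cons : ∀ {b w x xs} → 3 ≤ length (x ∷ xs) → col c w x ≡ b → Lollipop b (x ∷ xs) → Lollipop b (w ∷ x ∷ xs)
  Lollipop-cons {xs = []}        (s≤s ())       _  _
  Lollipop-cons {xs = _ ∷ []}    (s≤s (s≤s ())) _  _
  Lollipop-cons {xs = _ ∷ _ ∷ _} _              wx l = extend wx l

  Clique : Bool → List (Fin N) → Set
  Clique b = AllPairs (λ x y → col c x y ≡ b)

  clique⇒lollipop : ∀ {b xs} → Clique b xs → Lollipop b xs
  clique⇒lollipop []                                    = empty
  clique⇒lollipop (_ ∷ [])                              = single
  clique⇒lollipop ((xy ∷ []) ∷ _ ∷ [])                  = edge xy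
  clique⇒lollipop ((xy ∷ xz ∷ []) ∷ (yz ∷ []) ∷ _ ∷ []) = triangle xy yz (col-sym xz)
  clique⇒lollipop ((wx ∷ _) ∷ k@(_ ∷ _ ∷ _ ∷ _))        = extend wx (clique⇒lollipop k)

  lookup-consecutive : ∀ {b xs} → Lollipop b xs → (i j : Fin (length xs)) →
                       toℕ j ≡ suc (toℕ i) → col c (lookup xs i) (lookup xs j) ≡ b
  lookup-consecutive single            zero       zero             ()
  lookup-consecutive (edge xy)         zero       (suc zero)       _  = xy
  lookup-consecutive (edge _)          (suc zero) zero             ()
  lookup-consecutive (edge _)          (suc zero) (suc zero)       ()
  lookup-consecutive (triangle xy _ _) zero       (suc zero)       _  = xy
  lookup-consecutive (triangle _ yz _) (suc i)    (suc j)          eq = lookup-consecutive (edge yz) i j (suc-injective eq)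
  lookup-consecutive (extend wx _)     zero       (suc zero)       _  = wx
  lookup-consecutive (extend _ l)      (suc i)    (suc j)          eq = lookup-consecutive l i j (suc-injective eq)

  -- The last entry is v_1 and the third from last is v_3, so this edge closes the triangle.
  lookup-chord : ∀ {b xs} → Lollipop b xs → (i j : Fin (length xs)) →
                 1 + toℕ i ≡ length xs → 3 + toℕ j ≡ length xs → col c (lookup xs i) (lookup xs j) ≡ b
  lookup-chord (triangle _ _ zx) (suc (suc zero)) zero    _  _  = zx
  lookup-chord (extend _ l)      (suc i)          (suc j) ei ej = lookup-chord l i j (suc-injective ei) (suc-injective ej)

  Mono : ℕ → Set
  Mono k = ∃₂ λ b xs → Lollipop b xs × Unique xs × length xs ≡ k

  Mono≥ : ℕ → Set
  Mono≥ k = ∃₂ λ b xs → Lollipop b xs × Unique xs × k ≤ length xs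

  -- A lollipop can gain two vertices at once and overshoot `k`; dropping heads shortens it from its
  -- path end.
  Mono≥⇒Mono : ∀ {k} → Mono≥ k → Mono k
  Mono≥⇒Mono (b , xs , l , xs! , k≤) = trim xs l xs! k≤
    where
    trim : ∀ {k} xs → Lollipop b xs → Unique xs → k ≤ length xs → Mono k
    trim xs l xs! k≤ with m≤n⇒m<n∨m≡n k≤
    trim xs       l xs!       k≤ | inj₂ k≡ = b , xs , l , xs! , ≡-sym k≡
    trim (x ∷ xs) l (_ ∷ xs!) k≤ | inj₁ k< = trim xs (Lollipop-tail l) xs! (s≤s⁻¹ k<)

  lollipop⇒copy : ∀ {b xs} → Lollipop b xs → Unique xs → MonoCopy (PathPlus (length xs)) N c b
  lollipop⇒copy {b} {xs} l xs! = f , injective , adjacent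
    where
    k = length xs
    f : Fin k → Fin N
    -- The list runs from v_k down to v_1, hence the reversal.
    f i = lookup xs (opposite i)
    injective : Injective _≡_ _≡_ f
    injective {i} {j} eq = trans (≡-sym (opposite-involutive i))
      (trans (cong opposite (lookup-injective xs! eq)) (opposite-involutive j))
    forward : ∀ i j → toℕ j ≡ suc (toℕ i) → col c (f j) (f i) ≡ b
    forward i j eq = lookup-consecutive l (opposite j) (opposite i)
      (trans (opposite-prop i) (trans (+-∸-assoc 1 (subst (_< k) eq (toℕ<n j)))
        (cong suc (≡-sym (trans (opposite-prop j) (cong (λ m → k ∸ suc m) eq))))))
    chord : ∀ i j → toℕ i ≡ 0 → toℕ j ≡ 2 → col c (f i) (f j) ≡ b
    chord i j i≡0 j≡2 = lookup-chord l (opposite i) (opposite j) (opposite-at 0 i i≡0) (opposite-at 2 j j≡2)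
      where
      opposite-at : ∀ m (i : Fin k) → toℕ i ≡ m → suc m + toℕ (opposite i) ≡ k
      opposite-at m i refl = trans (cong (suc m +_) (opposite-prop i)) (m+[n∸m]≡n (toℕ<n i))
    adjacent : ∀ i j → PathPlus k i j → col c (f i) (f j) ≡ b
    adjacent i j (inj₁ (inj₁ eq))        = col-sym (forward i j eq)
    adjacent i j (inj₁ (inj₂ eq))        = forward j i eq
    adjacent i j (inj₂ (inj₁ (i0 , j2))) = chord i j i0 j2
    adjacent i j (inj₂ (inj₂ (i2 , j0))) = col-sym (chord j i j0 i2)

  -- Growing two disjoint lollipops of opposite colours.

  record LollipopPair (b : Bool) (s : ℕ) : Set where
    constructor pair
    field
      {left right} : List (Fin N)
      leftLollipop  : Lollipop b left
      rightLollipop : Lollipop (not b) right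
      disjoint      : Unique (left ++ right)
      total         : length left + length right ≡ s

  grow : ∀ {b} {P Q : List (Fin N)} → 3 ≤ length P → 3 ≤ length Q → length P + length Q < N →
         Lollipop b P → Lollipop (not b) Q → Unique (P ++ Q) → LollipopPair b (suc (length P + length Q))
  grow {b} {p ∷ P} {q ∷ Q} 3≤P 3≤Q small lP lQ PQ!
    with fresh ((p ∷ P) ++ q ∷ Q) (subst (_< N) (≡-sym (length-++ (p ∷ P))) small)
  ... | z , z∉ with cons! z∉ PQ! | ≡⊎≡not (col c z p) b | ≡⊎≡not (col c z q) b | ≡⊎≡not (col c p q) b
  ... | zPQ! | inj₁ zp | _ | _ = pair (Lollipop-cons 3≤P zp lP) lQ zPQ! refl
  ... | zPQ! | inj₂ zp | inj₂ zq | _ =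
    pair lP (Lollipop-cons 3≤Q zq lQ) (Unique-resp-↭ (↭-sym (shift z (p ∷ P) (q ∷ Q))) zPQ!) (+-suc (suc (length P)) (suc (length Q)))
  -- The vertex `q` changes sides and `z` follows it: one list loses a vertex, the other gains two.
  ... | zPQ! | inj₂ zp | inj₁ zq | inj₁ pq =
    pair (Lollipop-cons (m≤n⇒m≤1+n 3≤P) zq (Lollipop-cons 3≤P (col-sym pq) lP)) (Lollipop-tail lQ)
      (Unique-resp-↭ (prep z (shift q (p ∷ P) Q)) zPQ!)
      (cong suc (≡-sym (+-suc (suc (length P)) (length Q))))
  ... | zPQ! | inj₂ zp | inj₁ zq | inj₂ pq =
    pair (Lollipop-tail lP) (Lollipop-cons (m≤n⇒m≤1+n 3≤Q) zp (Lollipop-cons 3≤Q pq lQ))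
      (Unique-resp-↭ (↭-trans (prep z (↭-sym (shift p P (q ∷ Q)))) (↭-sym (shift z P (p ∷ q ∷ Q)))) zPQ!)
      (trans (+-suc (length P) _) (cong suc (+-suc (length P) _)))

  -- The total size grows as long as both lollipops keep at least three vertices,
  -- which 2 + n ≤ s guarantees while both have fewer than n.
  growPair : ∀ {n b s} d → n + n ≤ suc N → 2 + n ≤ s → n + n ≤ suc (d + s) → LollipopPair b s → Mono≥ n
  growPair {n} {b} d 2n≤N n≤s 2n≤s (pair {P} {Q} lP lQ PQ! refl)
    with n ≤? length P | n ≤? length Q
  ... | yes n≤P | _       = _ , P , lP , Unique-++⁻ˡ P PQ! , n≤P
  ... | no _    | yes n≤Q = _ , Q , lQ , Unique-++⁻ʳ P PQ! , n≤Q
  ... | no n≰P  | no n≰Q = continue d 2n≤s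
    where
    P<n = ≰⇒> n≰P
    Q<n = ≰⇒> n≰Q
    small : 2 + (length P + length Q) ≤ n + n
    small = subst (_≤ n + n) (cong suc (+-suc _ _)) (+-mono-≤ P<n Q<n)
    3≤P : 3 ≤ length P
    3≤P = +-cancelʳ-≤ _ 3 (length P) (≤-trans (s≤s (s≤s Q<n)) n≤s)
    3≤Q : 3 ≤ length Q
    3≤Q = +-cancelʳ-≤ _ 3 (length Q) (≤-trans (s≤s (s≤s P<n)) (subst (2 + n ≤_) (+-comm (length P) _) n≤s))
    continue : ∀ d → n + n ≤ suc (d + (length P + length Q)) → Mono≥ n
    -- `d` bounds the rounds left. At zero the total would be at least 2n - 1, but two lollipops
    -- below `n` have at most 2n - 2 vertices.
    continue zero    2n≤s = contradiction (≤-trans small 2n≤s) 1+n≰n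
    continue (suc d) 2n≤s = growPair d 2n≤N (m≤n⇒m≤1+n n≤s)
      (subst (λ m → n + n ≤ suc m) (≡-sym (+-suc d _)) 2n≤s)
      (grow 3≤P 3≤Q (s≤s⁻¹ (≤-trans small 2n≤N)) lP lQ PQ!)

  pair⇒Mono≥ : ∀ {n b} → n + n ≤ suc N → LollipopPair b (2 + n) → Mono≥ n
  pair⇒Mono≥ {n} 2n≤N = growPair (n + n) 2n≤N ≤-refl (m≤n⇒m≤1+n (m≤m+n (n + n) (2 + n)))

  -- Lengthening a single lollipop.

  allOrEdge : ∀ b z xs L → Unique (z ∷ xs ++ L) →
              All (λ x → col c z x ≡ b) xs ⊎ ∃ λ w → col c z w ≡ not b × Unique (z ∷ w ∷ L)
  allOrEdge b z []       L _ = inj₁ []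
  allOrEdge b z (x ∷ xs) L ((z≢x ∷ z≢) ∷ x≢ ∷ xs!) with ≡⊎≡not (col c z x) b | allOrEdge b z xs L (z≢ ∷ xs!)
  ... | _       | inj₂ e   = inj₂ e
  ... | inj₁ zx | inj₁ all = inj₁ (zx ∷ all)
  ... | inj₂ zx | inj₁ _   =
    inj₂ (x , zx , (z≢x ∷ ++⁻ʳ xs z≢) ∷ ++⁻ʳ xs x≢ ∷ Unique-++⁻ʳ xs xs!)

  -- Vertices outside `L` are collected one at a time; the first that fails to enlarge the clique
  -- supplies the edge.
  cliqueOrEdge : ∀ b L j → Unique L → j + length L ≤ N →
                 (∃ λ xs → Clique b xs × Unique (xs ++ L) × length xs ≡ j) ⊎
                 (∃₂ λ w w′ → col c w w′ ≡ not b × Unique (w ∷ w′ ∷ L))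
  cliqueOrEdge b L zero    L! _ = inj₁ ([] , [] , L! , refl)
  cliqueOrEdge b L (suc j) L! j≤ with cliqueOrEdge b L j L! (<⇒≤ j≤)
  ... | inj₂ e = inj₂ e
  ... | inj₁ (xs , k , xs! , refl) with fresh (xs ++ L) (subst (_< N) (≡-sym (length-++ xs)) j≤)
  ... | z , z∉ with allOrEdge b z xs L (cons! z∉ xs!)
  ... | inj₁ all         = inj₁ (z ∷ xs , all ∷ k , cons! z∉ xs! , refl)
  ... | inj₂ (w , e , u) = inj₂ (z , w , e , u)

  attach : ∀ {b v xs} z → 3 ≤ length (v ∷ xs) → Lollipop b (v ∷ xs) → Unique (z ∷ v ∷ xs) →
           Mono≥ (suc (length (v ∷ xs))) ⊎ col c z v ≡ not b
  attach {b} {v} z 3≤ l z! with ≡⊎≡not (col c z v) b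
  ... | inj₁ zv = inj₁ (_ , _ , Lollipop-cons 3≤ zv l , z! , ≤-refl)
  ... | inj₂ zv = inj₂ zv

  omit : ∀ {x₁ x₂ xs} y₁ y₂ → Unique (x₁ ∷ x₂ ∷ y₁ ∷ y₂ ∷ xs) → Unique {A = Fin N} (x₁ ∷ x₂ ∷ xs)
  omit {x₁} {x₂} y₁ y₂ xs! = drop⁺ 2 (Unique-resp-↭ (shifts (x₁ ∷ x₂ ∷ []) (y₁ ∷ y₂ ∷ [])) xs!)

  -- Call `b` red. Then `v`, `w`, `w′` is a blue triangle. Each case ends with `suc k` vertices in
  -- one lollipop or with a pair of total k + 3, which is 2 + n for n = `suc k`.
  lengthenByEdge : ∀ {b z w w′ v u r R} → let k = length (v ∷ u ∷ r ∷ R) in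
                   suc k + suc k ≤ suc N → Lollipop b (v ∷ u ∷ r ∷ R) → Unique (z ∷ w ∷ w′ ∷ v ∷ u ∷ r ∷ R) →
                   col c w w′ ≡ not b → col c w v ≡ not b → col c w′ v ≡ not b → col c z v ≡ not b → Mono≥ (suc k)
  -- For R = [] the list u ∷ r ∷ [] has no triangle, so it cannot be extended.
  lengthenByEdge {z = z} {w} {w′} {v} {R = []} _ _ zww′L! ww′ wv w′v zv =
    _ , z ∷ v ∷ w ∷ w′ ∷ [] , extend zv (triangle (col-sym wv) ww′ w′v) ,
    Unique-++⁻ˡ _ (Unique-resp-↭ (prep z (↭-trans (prep w (swap w′ v ↭-refl)) (swap w v ↭-refl))) zww′L!) , ≤-refl
  lengthenByEdge {b} {z} {w} {w′} {v} {u} {r} {R@(_ ∷ _)} 2k≤N l zww′L! ww′ wv w′v zv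
    with zwT! , zw′T! ← omit w′ v zww′L! , omit w v (Unique-resp-↭ (prep z (swap w w′ ↭-refl)) zww′L!)
    with ≡⊎≡not (col c u w) b | ≡⊎≡not (col c u z) b | ≡⊎≡not (col c z w) b | ≡⊎≡not (col c z w′) b
  -- `w` and `z` replace `v` at the red end.
  ... | inj₁ uw | _ | inj₁ zw | _ =
    _ , _ , extend zw (extend (col-sym uw) (Lollipop-tail l)) , zwT! , ≤-refl
  -- `v` moves to the blue side, where `z` hangs on the triangle at `w`: (k - 1) + 4 vertices.
  ... | inj₁ uw | _ | inj₂ zw | _ = pair⇒Mono≥ 2k≤N
    (pair (Lollipop-tail l) (extend zw (triangle wv (col-sym w′v) (col-sym ww′)))
      (Unique-resp-↭ (↭-trans (prep z (prep w (swap w′ v ↭-refl))) (++-comm (z ∷ w ∷ v ∷ w′ ∷ []) (u ∷ r ∷ R))) zww′L!)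
      (+-comm (length (u ∷ r ∷ R)) 4))
  -- Both `v` and `u` move to the blue side: (k - 2) + 5 vertices.
  ... | inj₂ uw | inj₂ uz | _ | _ = pair⇒Mono≥ 2k≤N
    (pair (Lollipop-tail (Lollipop-tail l)) (extend (col-sym uz) (extend uw (triangle ww′ w′v (col-sym wv))))
      (Unique-resp-↭ (↭-trans (prep z (shift u (w ∷ w′ ∷ v ∷ []) (r ∷ R))) (++-comm (z ∷ u ∷ w ∷ w′ ∷ v ∷ []) (r ∷ R))) zww′L!)
      (+-comm (length (r ∷ R)) 5))
  ... | inj₂ _ | inj₁ uz | inj₁ zw | _ =
    _ , _ , extend (col-sym zw) (extend (col-sym uz) (Lollipop-tail l)) , Unique-resp-↭ (swap z w ↭-refl) zwT! , ≤-refl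
  ... | inj₂ _ | inj₁ uz | inj₂ _ | inj₁ zw′ =
    _ , _ , extend (col-sym zw′) (extend (col-sym uz) (Lollipop-tail l)) , Unique-resp-↭ (swap z w′ ↭-refl) zw′T! , ≤-refl
  -- The red lollipop stays whole beside the blue triangle `z`, `w`, `w′`: k + 3 vertices.
  ... | inj₂ _ | inj₁ _ | inj₂ zw | inj₂ zw′ = pair⇒Mono≥ 2k≤N
    (pair l (triangle zw ww′ (col-sym zw′)) (Unique-resp-↭ (++-comm (z ∷ w ∷ w′ ∷ []) (v ∷ u ∷ r ∷ R)) zww′L!)
      (+-comm (length (v ∷ u ∷ r ∷ R)) 3))

  lengthen : ∀ {k} → 3 ≤ k → suc k + suc k ≤ suc N → Mono k → Mono≥ (suc k)
  lengthen ()             _    (_ , []         , _ , _  , refl)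
  lengthen (s≤s ())       _    (_ , _ ∷ []     , _ , _  , refl)
  lengthen (s≤s (s≤s ())) _    (_ , _ ∷ _ ∷ [] , _ , _  , refl)
  lengthen {k} 3≤k        2k≤N (b , L@(v ∷ u ∷ r ∷ R) , l , L! , refl)
    -- Since N ≥ 2k + 1, at least `suc k` vertices lie outside `L`, and a clique on that many
    -- contains the desired lollipop.
    with cliqueOrEdge b L (suc k) L! (subst (_≤ N) (+-suc k k) (s≤s⁻¹ 2k≤N))
  ... | inj₁ (xs , K , xs! , len) = b , xs , clique⇒lollipop K , Unique-++⁻ˡ xs xs! , ≤-reflexive (≡-sym len)
  ... | inj₂ (w , w′ , ww′ , ww′L!@((_ ∷ w≢) ∷ w′L!@(_ ∷ _)))
    -- There is room for `z` because 3 + k ≤ k + k < N.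
    with fresh (w ∷ w′ ∷ L) (≤-trans (+-monoˡ-≤ k 3≤k) (≤-trans (+-monoʳ-≤ k (n≤1+n k)) (s≤s⁻¹ 2k≤N)))
  ... | z , z∉ with cons! z∉ ww′L!
  ... | zww′L!@((_ ∷ _ ∷ z≢) ∷ _) with attach w 3≤k l (w≢ ∷ L!) | attach w′ 3≤k l w′L! | attach z 3≤k l (z≢ ∷ L!)
  ... | inj₁ m  | _        | _       = m
  ... | inj₂ _  | inj₁ m   | _       = m
  ... | inj₂ _  | inj₂ _   | inj₁ m  = m
  ... | inj₂ wv | inj₂ w′v | inj₂ zv = lengthenByEdge 2k≤N l zww′L! ww′ wv w′v zv

  -- The three-vertex case.

  starTriangle : ∀ {b v} xs → 3 ≤ length xs → All (λ x → col c v x ≡ b) xs → Unique (v ∷ xs) → Mono≥ 3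
  starTriangle []           ()             _ _
  starTriangle (_ ∷ [])     (s≤s ())       _ _
  starTriangle (_ ∷ _ ∷ []) (s≤s (s≤s ())) _ _
  starTriangle {b} {v} (x ∷ y ∷ z ∷ xs) _ (vx ∷ vy ∷ vz ∷ _) ((v≢x ∷ v≢y ∷ v≢z ∷ _) ∷ (x≢y ∷ x≢z ∷ _) ∷ (y≢z ∷ _) ∷ _)
    with ≡⊎≡not (col c x y) b | ≡⊎≡not (col c y z) b | ≡⊎≡not (col c z x) b
  ... | inj₁ xy | _       | _       = _ , _ , triangle vx xy (col-sym vy) , (v≢x ∷ v≢y ∷ []) ∷ (x≢y ∷ []) ∷ [] ∷ [] , ≤-refl
  ... | inj₂ _  | inj₁ yz | _       = _ , _ , triangle vy yz (col-sym vz) , (v≢y ∷ v≢z ∷ []) ∷ (y≢z ∷ []) ∷ [] ∷ [] , ≤-refl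
  ... | inj₂ _  | inj₂ _  | inj₁ zx = _ , _ , triangle vx (col-sym zx) (col-sym vz) , (v≢x ∷ v≢z ∷ []) ∷ (x≢z ∷ []) ∷ [] ∷ [] , ≤-refl
  ... | inj₂ xy | inj₂ yz | inj₂ zx = _ , _ , triangle xy yz zx , (x≢y ∷ x≢z ∷ []) ∷ (y≢z ∷ []) ∷ [] ∷ [] , ≤-refl

  -- The classical R(3,3) ≤ 6: five neighbours of `v` are drawn and sorted by colour, `d` of them
  -- still to come; finally some colour has three.
  star : ∀ d {v} xs ys → All (λ x → col c v x ≡ red) xs → All (λ y → col c v y ≡ blue) ys →
         Unique (v ∷ xs ++ ys) → d + (length xs + length ys) ≡ 5 → 6 ≤ N → Mono≥ 3
  star zero {v} xs ys reds blues xys!@(v≢ ∷ _) len _ with 3 ≤? length xs | 3 ≤? length ys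
  ... | yes 3≤xs | _        = starTriangle xs 3≤xs reds (Unique-++⁻ˡ (v ∷ xs) xys!)
  ... | no _     | yes 3≤ys = starTriangle ys 3≤ys blues (Unique-++⁻ʳ xs (Unique-resp-↭ (↭-sym (shift v xs ys)) xys!))
  ... | no 3≰xs  | no 3≰ys  = contradiction (subst (_≤ 4) len (+-mono-≤ (s≤s⁻¹ (≰⇒> 3≰xs)) (s≤s⁻¹ (≰⇒> 3≰ys)))) 1+n≰n
  star (suc d) {v} xs ys reds blues xys! len 6≤N
    with fresh (v ∷ xs ++ ys) (≤-trans (s≤s (s≤s (subst (_≤ 4) (≡-sym (length-++ xs)) (m+n≤o⇒n≤o d (≤-reflexive (suc-injective len)))))) 6≤N)
  ... | z , z∉ with cons! z∉ xys! | ≡⊎≡not (col c v z) red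
  ... | zxys! | inj₁ vz = star d (z ∷ xs) ys (vz ∷ reds) blues (Unique-resp-↭ (swap z v ↭-refl) zxys!) (trans (+-suc d _) len) 6≤N
  ... | zxys! | inj₂ vz = star d xs (z ∷ ys) reds (vz ∷ blues)
    (Unique-resp-↭ (↭-trans (swap z v ↭-refl) (prep v (↭-sym (shift z xs ys)))) zxys!)
    (trans (cong (d +_) (+-suc _ _)) (trans (+-suc d _) len)) 6≤N

  -- The induction starts at the triangle, which needs six vertices rather than 2 * 3 - 1, so
  -- `6 ≤ N` is carried along; `4 ≤ t` provides it.
  mono : ∀ j → 6 ≤ N → (3 + j) + (3 + j) ≤ suc N → Mono (3 + j)
  mono zero    6≤N _    = Mono≥⇒Mono (star 5 {fromℕ< 6≤N} [] [] [] [] ([] ∷ []) refl 6≤N)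
  mono (suc j) 6≤N 2k≤N = Mono≥⇒Mono (lengthen (m≤m+n 3 j) 2k≤N
    (mono j 6≤N (≤-trans (+-mono-≤ (n≤1+n (3 + j)) (n≤1+n (3 + j))) 2k≤N)))

arrows : ∀ {t N} → 4 ≤ t → t + t ≤ suc N → Arrows N (PathPlus t) (PathPlus t)
arrows {suc zero}          (s≤s ())
arrows {suc (suc zero)}    (s≤s (s≤s ()))
arrows {suc (suc (suc j))} 4≤t 2t≤N c with mono c j (≤-trans (n≤1+n 6) (s≤s⁻¹ (≤-trans (+-mono-≤ 4≤t 4≤t) 2t≤N))) 2t≤N
... | true  , xs , l , xs! , len = inj₁ (subst (λ k → MonoCopy (PathPlus k) _ c red)  len (lollipop⇒copy c l xs!))
... | false , xs , l , xs! , len = inj₂ (subst (λ k → MonoCopy (PathPlus k) _ c blue) len (lollipop⇒copy c l xs!))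

-- The lower bound.

not-xor : ∀ {x y} → not (x xor y) ≡ red → x ≡ y
not-xor {false} {false} _ = refl
not-xor {true}  {true}  _ = refl

no-three-distinct : ∀ x y z → not (x xor y) ≡ blue → not (y xor z) ≡ blue → not (x xor z) ≡ blue → ⊥
no-three-distinct false true false _ _ ()
no-three-distinct true false true  _ _ ()

module _ (s m : ℕ) where

  side : Fin m → Bool
  side i = toℕ i <ᵇ s

  -- With `m` left free, every order up to `s + s` gets its own colouring, and no monotonicity in
  -- `m` has to be shown.
  twoCliques : Colouring m
  twoCliques .col i j = not (side i xor side j)
  twoCliques .sym i j = cong not (xor-comm (side i) (side j))

  side-true⇒< : ∀ i → side i ≡ true → toℕ i < s
  side-true⇒< i eq = <ᵇ⇒< (toℕ i) s (subst T (≡-sym eq) tt)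

  side-false⇒≥ : ∀ i → side i ≡ false → s ≤ toℕ i
  side-false⇒≥ i eq = ≮⇒≥ λ i<s → subst T eq (<⇒<ᵇ i<s)

  -- Red edges stay on one side, so a red path would place `suc s` distinct vertices on a side of at
  -- most `s`.
  noRedPath : m ≤ s + s → ¬ MonoCopy (PathPlus (suc s)) m twoCliques red
  noRedPath m≤2s (f , f-inj , f-red) = onSide (side (f zero)) sameSide
    where
    sameSide : ∀ i → side (f i) ≡ side (f zero)
    sameSide = <-weakInduction _ refl λ i ih → trans
      (not-xor (f-red (suc i) (inject₁ i) (inj₁ (inj₂ (cong suc (≡-sym (toℕ-inject₁ i))))))) ih
    embed : (g : Fin (suc s) → ℕ) → (∀ i → g i < s) → (∀ {i j} → g i ≡ g j → toℕ (f i) ≡ toℕ (f j)) → ⊥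
    embed g g< g-inj = 1+n≰n (injective⇒≤ {f = λ i → fromℕ< (g< i)} λ {i} {j} eq →
      f-inj (toℕ-injective (g-inj (fromℕ<-injective (g i) (g j) (g< i) (g< j) eq))))
    onSide : ∀ b → (∀ i → side (f i) ≡ b) → ⊥
    onSide true  all = embed (toℕ ∘ f) (λ i → side-true⇒< (f i) (all i)) (λ eq → eq)
    -- Subtracting `s` maps the upper side into the numbers below `s`, as `m ≤ s + s`.
    onSide false all = embed (λ i → toℕ (f i) ∸ s)
      (λ i → subst (toℕ (f i) ∸ s <_) (m+n∸m≡n s s) (∸-monoˡ-< (<-≤-trans (toℕ<n (f i)) m≤2s) (≥s i)))
      (λ {i} {j} → ∸-cancelʳ-≡ (≥s i) (≥s j))
      where
      ≥s : ∀ i → s ≤ toℕ (f i)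
      ≥s i = side-false⇒≥ (f i) (all i)

  -- The blue graph is bipartite, while vertices 0, 1, 2 form a triangle.
  noBlueTriangle : ∀ {k} → ¬ MonoCopy (PathPlus (3 + k)) m twoCliques blue
  noBlueTriangle (f , _ , f-blue) = no-three-distinct (side (f zero)) (side (f (suc zero))) (side (f (suc (suc zero))))
    (f-blue _ _ (inj₁ (inj₁ refl))) (f-blue _ _ (inj₁ (inj₁ refl))) (f-blue _ _ (inj₂ (inj₁ (refl , refl))))

theorem9 : (t : ℕ) → 4 ≤ t → IsRamseyNumber (PathPlus t) (PathPlus t) (2 * t ∸ 1)
theorem9 t@(suc s@(suc (suc _))) 4≤t = arrows 4≤t (≤-reflexive 2t≡) , λ m m<N arrow →
  [ noRedPath s m (s≤s⁻¹ (subst (m <_) N≡ m<N)) , noBlueTriangle s m ]′ (arrow (twoCliques s m))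
  where
  N≡ : 2 * t ∸ 1 ≡ suc (s + s)
  N≡ = trans (+-suc s _) (cong (λ n → suc (s + n)) (+-identityʳ s))
  2t≡ : t + t ≡ suc (2 * t ∸ 1)
  2t≡ = cong (λ n → t + n) (≡-sym (+-identityʳ t))
theorem9 (suc zero)       (s≤s ())
theorem9 (suc (suc zero)) (s≤s (s≤s ()))
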